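{- Let $q$ be a positive integer. A two-spine configuration $P\subseteq\Omega_{2,q}$ is coverable if and only if, viewed as a bipartite graph, it is a pseudoforest; equivalently, every connected component contains at most one cycle.
   Context: $[q]=\{0,\dots,q-1\}$ and $\Omega_{2,q}=\{(x,y)\in[q]^2:x\ne y\}$. A two-spine configuration is a subset $P\subseteq\Omega_{2,q}$. It is viewed as a bipartite graph: an ordered pair $(x,y)\in P$ is an edge joining the row copy of $x$ to the column copy of $y$; row $c$ and column $c$ are distinct vertices (and the diagonal edge $(c,c)$ never occurs). $P$ is coverable if it can be partitioned as $P=P_1\,\dot\cup\,P_2$ (parts may be empty) where $P_1$ contains at most one pair with any given second coordinate and $P_2$ contains at most one pair with any given first coordinate. A pseudoforest is a graph in which every connected component contains at most one cycle. -}

module Defs where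

open import Data.Fin.Base using (Fin; toℕ)
open import Data.Nat.Base using (ℕ; suc; _+_)
open import Data.Nat.DivMod using (_mod_)
open import Data.Product.Base using (_×_; _,_; ∃-syntax)
open import Data.Sum.Base using (_⊎_)
open import Function.Bundles using (_⇔_)
open import Function.Definitions using (Injective)
open import Level using (0ℓ)
open import Relation.Binary.Construct.Closure.ReflexiveTransitive using (Star)
open import Relation.Binary.Core using (Rel)
open import Relation.Binary.Definitions using (Irreflexive; Symmetric)
open import Relation.Binary.PropositionalEquality.Core using (_≡_; _≢_; refl)
open import Relation.Unary using (Pred; Decidable; _∈_; _⊆_; _∪_; _≐_; _⊥_)

------------------------------------------------------------------------
-- Simple graphs, cycles and pseudoforests

record Graph : Set₁ where
  field
    Vertex : Set
    Adj    : Rel Vertex 0ℓ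
    sym    : Symmetric Adj
    irrefl : Irreflexive _≡_ Adj

module _ (G : Graph) where
  open Graph G

  Component : Vertex → Pred Vertex 0ℓ
  Component v w = Star Adj v w

  -- Graphs here have no loops or multiple edges, so a cycle has length
  -- 3 + excess ≥ 3.
  record Cycle : Set where
    field
      excess : ℕ

    next : Fin (3 + excess) → Fin (3 + excess)
    next i = suc (toℕ i) mod (3 + excess)

    field
      vertex   : Fin (3 + excess) → Vertex
      distinct : Injective _≡_ _≡_ vertex
      adjacent : ∀ i → Adj (vertex i) (vertex (next i))

    Edge : Rel Vertex 0ℓ
    Edge u v = ∃[ i ] ((u ≡ vertex i × v ≡ vertex (next i))
                     ⊎ (v ≡ vertex i × u ≡ vertex (next i)))

  -- Cycles are compared as subgraphs: the starting point and the direction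
  -- of traversal are irrelevant, and the edges determine the vertices.
  SameCycle : Rel Cycle 0ℓ
  SameCycle C D = ∀ u v → Cycle.Edge C u v ⇔ Cycle.Edge D u v

  _LiesIn_ : Cycle → Pred Vertex 0ℓ → Set
  C LiesIn K = ∀ i → Cycle.vertex C i ∈ K

  IsPseudoforest : Set
  IsPseudoforest = ∀ v (C D : Cycle) →
    C LiesIn Component v → D LiesIn Component v → SameCycle C D

------------------------------------------------------------------------
-- Two-spine configurations

Ω₂ : ∀ q → Pred (Fin q × Fin q) 0ℓ
Ω₂ q (x , y) = x ≢ y

-- Decidability of membership makes pairs range over the subsets of a finite
-- set in the ordinary sense.
record TwoSpine (q : ℕ) : Set₁ where
  field
    pairs : Pred (Fin q × Fin q) 0ℓ
    pairs? : Decidable pairs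
    pairs⊆Ω₂ : pairs ⊆ Ω₂ q

-- The two parts need no decidability assumption: as complementary parts of
-- a decidable set they are automatically decidable.
Coverable : ∀ {q} → TwoSpine q → Set₁
Coverable {q} P =
  ∃[ P₁ ] ∃[ P₂ ]
    (pairs ≐ P₁ ∪ P₂) × (P₁ ⊥ P₂) × AtMostOnePerColumn P₁ × AtMostOnePerRow P₂
  where
  open TwoSpine P

  AtMostOnePerColumn AtMostOnePerRow : Pred (Fin q × Fin q) 0ℓ → Set
  AtMostOnePerColumn S = ∀ {x x′ y} → (x , y) ∈ S → (x′ , y) ∈ S → x ≡ x′
  AtMostOnePerRow    S = ∀ {x y y′} → (x , y) ∈ S → (x , y′) ∈ S → y ≡ y′

data RowCol (q : ℕ) : Set where
  row col : Fin q → RowCol q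

data Joined {q} (P : TwoSpine q) : Rel (RowCol q) 0ℓ where
  row-col : ∀ {x y} → (x , y) ∈ TwoSpine.pairs P → Joined P (row x) (col y)
  col-row : ∀ {x y} → (x , y) ∈ TwoSpine.pairs P → Joined P (col y) (row x)

bipartiteGraph : ∀ {q} → TwoSpine q → Graph
bipartiteGraph {q} P = record
  { Vertex = RowCol q
  ; Adj    = Joined P
  ; sym    = λ { (row-col p) → col-row p ; (col-row p) → row-col p }
  ; irrefl = λ { refl () }
  }

{-# OPTIONS --safe #-}
-- Both conditions say that the edges can be assigned injectively to endpoints,
-- i.e. that the graph has an orientation with out-degree at most one: an edge
-- in P₁ is owned by its column, an edge in P₂ by its row.
--
-- Given such an orientation, every cycle is directed, so following out-edges
-- never leaves it.  The vertices from which a given cycle is reached along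
-- out-edges are closed under adjacency, so a second cycle of the component
-- reaches the first one, hence meets it, hence has the same edges.
--
-- Conversely, edges are inserted one at a time.  To insert uv it suffices that
-- some endpoint has no out-edge, and this can be arranged by reversing its
-- out-path unless that path runs into a cycle.  If the out-paths of both u and
-- v do, these cycles lie in one component and therefore coincide, so u and v
-- are already joined by a simple path; with uv it closes up to a cycle which,
-- unlike the first one, contains uv.
module Submission where

open import Defs
open import Data.Empty using (⊥; ⊥-elim)
open import Data.Fin.Base using (Fin; zero; suc; toℕ; fromℕ<)
import Data.Fin.Properties as Fin
open import Data.List.Base using (List; []; _∷_; allFin; cartesianProduct; filter; map)
open import Data.List.Membership.Propositional.Properties
  using (∈-allFin; ∈-cartesianProduct⁺; ∈-filter⁺; ∈-map⁺)
open import Data.List.Relation.Unary.All as All using (All; []; _∷_)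
import Data.List.Relation.Unary.All.Properties as All
open import Data.List.Relation.Unary.Any using (satisfied)
open import Data.Maybe.Base using (Maybe; just; nothing; fromMaybe)
open import Data.Maybe.Properties using (just-injective; ≡-dec)
open import Data.Nat.Base
open import Data.Nat.Divisibility using (_∣_; divides; ∣⇒≤)
open import Data.Nat.DivMod
open import Data.Nat.Properties
open import Data.Product.Base using (_×_; _,_; ∃-syntax; proj₁; proj₂; uncurry)
open import Data.Sum.Base as Sum using (_⊎_; inj₁; inj₂; [_,_]′)
open import Data.Sum.Properties using (inj₁-injective; inj₂-injective)
open import Function.Base using (_∘_; case_of_)
open import Function.Bundles using (_⇔_; _↣_; mk⇔; mk↣; Injection; Equivalence)
open import Function.Construct.Composition using (_↣-∘_)
open import Function.Properties.Inverse using (↔⇒↣)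
import Function.Construct.Symmetry as Symmetry
open import Level using (0ℓ)
open import Relation.Binary.Construct.Closure.ReflexiveTransitive as Star
  using (Star; ε; _◅_; _◅◅_)
open import Relation.Binary.Core using (Rel)
open import Relation.Binary.Definitions using (DecidableEquality)
open import Relation.Binary.PropositionalEquality
open import Relation.Nullary using (¬_; yes; no; contradiction)
open import Relation.Nullary.Decidable using (via-injection; _⊎-dec_)

-- The cyclic successor

succ : ∀ {n} .{{_ : NonZero n}} → Fin n → Fin n
succ {n} i = suc (toℕ i) mod n

toℕ-mod : ∀ m n .{{_ : NonZero n}} → toℕ (m mod n) ≡ m % n
toℕ-mod m n = Fin.toℕ-fromℕ< (m%n<n m n)

mod-cong : ∀ {m o n} .{{_ : NonZero n}} → m % n ≡ o % n → m mod n ≡ o mod n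
mod-cong {m} {o} {n} eq =
  Fin.toℕ-injective (trans (toℕ-mod m n) (trans eq (sym (toℕ-mod o n))))

toℕ-mod-cancel : ∀ {n} .{{_ : NonZero n}} (i : Fin n) → toℕ i mod n ≡ i
toℕ-mod-cancel {n} i =
  Fin.toℕ-injective (trans (toℕ-mod (toℕ i) n) (m<n⇒m%n≡m (Fin.toℕ<n i)))

suc-% : ∀ m n .{{_ : NonZero n}} → suc (m % n) % n ≡ suc m % n
suc-% m n = begin
  suc (m % n) % n              ≡⟨ %-distribˡ-+ 1 (m % n) n ⟩
  (1 % n + (m % n) % n) % n    ≡⟨ cong (λ k → (1 % n + k) % n) (m%n%n≡m%n m n) ⟩
  (1 % n + m % n) % n          ≡⟨ %-distribˡ-+ 1 m n ⟨
  suc m % n                    ∎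
  where open ≡-Reasoning

succ-mod : ∀ m n .{{_ : NonZero n}} → succ (m mod n) ≡ suc m mod n
succ-mod m n = mod-cong (trans (cong (λ k → suc k % n) (toℕ-mod m n)) (suc-% m n))

succ-induction : ∀ {n} .{{_ : NonZero n}} (P : Fin n → Set) →
  (∀ i → P i → P (succ i)) → ∀ {i} → P i → ∀ j → P j
-- The number of steps is `j` minus `i` modulo `n`; adding `n` before subtracting keeps the
-- truncated subtraction exact.
succ-induction {n} P step {i} Pi j = subst P arrive (go (toℕ j + (n ∸ toℕ i)))
  where
  go : ∀ k → P ((k + toℕ i) mod n)
  go zero    = subst P (sym (toℕ-mod-cancel i)) Pi
  go (suc k) = subst P (succ-mod (k + toℕ i) n) (step _ (go k))

  arrive : (toℕ j + (n ∸ toℕ i) + toℕ i) mod n ≡ j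
  arrive = trans
    (mod-cong (begin
      (toℕ j + (n ∸ toℕ i) + toℕ i) % n   ≡⟨ cong (_% n) (+-assoc (toℕ j) _ _) ⟩
      (toℕ j + (n ∸ toℕ i + toℕ i)) % n   ≡⟨ cong (λ k → (toℕ j + k) % n) (m∸n+n≡m (<⇒≤ (Fin.toℕ<n i))) ⟩
      (toℕ j + n) % n                     ≡⟨ [m+n]%n≡m%n (toℕ j) n ⟩
      toℕ j % n                           ∎))
    (toℕ-mod-cancel j)
    where open ≡-Reasoning

pred-induction : ∀ {n} .{{_ : NonZero n}} (P : Fin n → Set) →
  (∀ i → P (succ i) → P i) → ∀ {i} → P i → ∀ j → P j
pred-induction P step {i} Pi j =
  -- Forward induction on the implication into `P j`, started from the identity at `j`.
  succ-induction (λ k → P k → P j) (λ k f → f ∘ step k) {j} (λ p → p) i Pi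

succ-surjective : ∀ {n} .{{_ : NonZero n}} (j : Fin n) → ∃[ i ] succ i ≡ j
succ-surjective j =
  succ-induction (λ j → ∃[ i ] succ i ≡ j) (λ i _ → i , refl) (j , refl) j

-- Otherwise the length `3 + m` would divide 2. This is where the minimal cycle length enters the
-- orientation argument.
succ-succ-≢ : ∀ {m} (i : Fin (3 + m)) → succ (succ i) ≢ i
succ-succ-≢ {m} i eq = <⇒≱ (s≤s (s≤s (s≤s z≤n))) (∣⇒≤ n∣2)
  where
  n = 3 + m
  a = toℕ i

  [2+a]%n≡a : (2 + a) % n ≡ a
  [2+a]%n≡a = trans (sym (trans (cong toℕ (succ-mod (suc a) n)) (toℕ-mod (2 + a) n))) (cong toℕ eq)

  n∣2 : n ∣ 2
  n∣2 = divides ((2 + a) / n) (+-cancelˡ-≡ a 2 _ (begin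
    a + 2                              ≡⟨ +-comm a 2 ⟩
    2 + a                              ≡⟨ m≡m%n+[m/n]*n (2 + a) n ⟩
    (2 + a) % n + (2 + a) / n * n      ≡⟨ cong (_+ (2 + a) / n * n) [2+a]%n≡a ⟩
    a + (2 + a) / n * n                ∎))
    where open ≡-Reasoning

-- Each index brings its own alternative, so a finite search decides without `P` or `Q` being
-- decidable.
∀⊎∃ : ∀ {n} {P Q : Fin n → Set} → (∀ i → P i ⊎ Q i) → (∀ i → P i) ⊎ ∃[ i ] Q i
∀⊎∃ p⊎q = Sum.map (λ all i → All.lookup all (∈-allFin i)) satisfied
  (All.decide p⊎q (allFin _))

-- Orientations of out-degree at most one force pseudoforests

module _ (G : Graph) where
  open Graph G renaming (sym to adj-sym)

  edge-sym : ∀ (C : Cycle G) {u v} → Cycle.Edge C u v → Cycle.Edge C v u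
  edge-sym C (i , e) = i , Sum.swap e

  edge-source : ∀ (C : Cycle G) {u v} → Cycle.Edge C u v → ∃[ i ] u ≡ Cycle.vertex C i
  edge-source C (i , inj₁ (u≡ , _)) = i , u≡
  edge-source C (i , inj₂ (_ , u≡)) = Cycle.next C i , u≡

  liesIn : ∀ (C : Cycle G) {v i} → Component G v (Cycle.vertex C i) →
           _LiesIn_ G C (Component G v)
  liesIn C {v} {i} = succ-induction (λ i → Component G v (Cycle.vertex C i))
    (λ i v⟶i → v⟶i ◅◅ (Cycle.adjacent C i ◅ ε)) {i}

  module _
    (Out : Rel Vertex 0ℓ)
    (functional : ∀ {u v w} → Out u v → Out u w → v ≡ w)
    (covers : ∀ {u v} → Adj u v → Out u v ⊎ Out v u)
    where

    module _ (C : Cycle G) where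
      open Cycle C

      Forward Backward : Set
      Forward  = ∀ i → Out (vertex i) (vertex (succ i))
      Backward = ∀ i → Out (vertex (succ i)) (vertex i)

      -- One backward edge makes the next one backward too: otherwise their common vertex would have
      -- two out-neighbours, distinct because they are two steps apart on the cycle. So it
      -- propagates all the way round.
      directed : Forward ⊎ Backward
      directed with ∀⊎∃ (λ i → covers (adjacent i))
      ... | inj₁ forward    = inj₁ forward
      ... | inj₂ (i , back) = inj₂ (succ-induction _ step {i} back)
        where
        step : ∀ i → Out (vertex (succ i)) (vertex i) →
               Out (vertex (succ (succ i))) (vertex (succ i))
        step i back with covers (adjacent (succ i))
        ... | inj₁ forth = contradiction (distinct (functional forth back)) (succ-succ-≢ i)
        ... | inj₂ back′ = back′

      -- A directed cycle already has an out-edge at each of its vertices, and functionality leaves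
      -- room for no other.
      out-edge : ∀ i {v} → Out (vertex i) v → Edge (vertex i) v
      out-edge i out with directed
      ... | inj₁ forward  = i , inj₁ (refl , functional out (forward i))
      ... | inj₂ backward with j , refl ← succ-surjective i =
        j , inj₂ (functional out (backward j) , refl)

      OnCycle : Vertex → Set
      OnCycle v = ∃[ i ] v ≡ vertex i

      onCycle-closed : ∀ {u v} → Out u v → OnCycle u → OnCycle v
      onCycle-closed out (i , refl) = edge-source C (edge-sym C (out-edge i out))

      out-closed-∀ : (Q : Vertex → Set) → (∀ {u v} → Out u v → Q u → Q v) →
                     ∀ {i} → Q (vertex i) → ∀ j → Q (vertex j)
      out-closed-∀ Q closed with directed
      ... | inj₁ forward  = succ-induction (Q ∘ vertex) (λ i → closed (forward i))
      ... | inj₂ backward = pred-induction (Q ∘ vertex) (λ i → closed (backward i))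

      Reaches : Vertex → Set
      Reaches v = ∃[ i ] Star Out v (vertex i)

      -- If `v` owns the edge, prepend it to the path. If `u` does, a nonempty path from `u` must
      -- start with this edge, which is dropped; an empty one means that `u` is on the cycle, hence
      -- so is `v`.
      reaches-adj : ∀ {u v} → Adj u v → Reaches u → Reaches v
      reaches-adj adj (i , path) with covers adj
      reaches-adj adj (i , path)        | inj₂ in-edge = i , in-edge ◅ path
      reaches-adj adj (i , ε)           | inj₁ out with j , refl ← onCycle-closed out (i , refl) = j , ε
      reaches-adj adj (i , out′ ◅ path) | inj₁ out with refl ← functional out out′ = i , path

      reaches-star : ∀ {u v} → Star Adj u v → Reaches u → Reaches v
      reaches-star ε            r = r
      reaches-star (adj ◅ path) r = reaches-star path (reaches-adj adj r)

    onCycle-star : ∀ C {u v} → Star Out u v → OnCycle C u → OnCycle C v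
    onCycle-star C ε            on = on
    onCycle-star C (out ◅ path) on = onCycle-star C path (onCycle-closed C out on)

    -- One common vertex drags all of `C` onto `D`. Each edge of `C` is then the out-edge of a
    -- vertex of `D`, hence an edge of `D`.
    meeting-edges : ∀ C D {i} → OnCycle D (Cycle.vertex C i) →
                    ∀ {u v} → Cycle.Edge C u v → Cycle.Edge D u v
    meeting-edges C D {i} meet e = edge (edge-source C e) (edge-source C (edge-sym C e)) (covers (adj e))
      where
      C⊆D : ∀ j → OnCycle D (Cycle.vertex C j)
      C⊆D = out-closed-∀ C (OnCycle D) (onCycle-closed D) {i} meet

      adj : ∀ {u v} → Cycle.Edge C u v → Adj u v
      adj (i , inj₁ (refl , refl)) = Cycle.adjacent C i
      adj (i , inj₂ (refl , refl)) = adj-sym (Cycle.adjacent C i)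

      edge : ∀ {u v} → OnCycle C u → OnCycle C v → Out u v ⊎ Out v u → Cycle.Edge D u v
      edge (j , refl) _ (inj₁ out) with k , eq ← C⊆D j =
        subst (λ u → Cycle.Edge D u _) (sym eq) (out-edge D k (subst (λ u → Out u _) eq out))
      edge _ (j , refl) (inj₂ out) with k , eq ← C⊆D j =
        edge-sym D (subst (λ v → Cycle.Edge D v _) (sym eq) (out-edge D k (subst (λ v → Out v _) eq out)))

    oriented⇒pseudoforest : IsPseudoforest G
    oriented⇒pseudoforest v C D C⊆K D⊆K
      -- A vertex of `C` trivially reaches `C`, so a vertex of `D` does as well; its path cannot
      -- leave `D`, so it ends at a common vertex.
      with i , path ← reaches-star C (Star.reverse adj-sym (C⊆K zero) ◅◅ D⊆K zero) (zero , ε)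
      with j , eq ← onCycle-star D path (zero , refl)
      = λ _ _ → mk⇔ (meeting-edges C D {i} (j , eq)) (meeting-edges D C {j} (i , sym eq))

-- Simple paths and cycles from sequences of vertices

module _ {V : Set} where

  -- Sequences are total on `ℕ` with a separate bound, so that shifting and prepending need no casts
  -- between `Fin` types.
  InjectiveBelow : ℕ → (ℕ → V) → Set
  InjectiveBelow n w = ∀ {a b} → a < n → b < n → w a ≡ w b → a ≡ b

  FirstRepeat : ℕ → (ℕ → V) → Set
  FirstRepeat n w = ∃[ i ] ∃[ j ] i < j × j < n × w j ≡ w i × InjectiveBelow j w

  infixr 5 _◂_
  _◂_ : V → (ℕ → V) → ℕ → V
  (v ◂ w) zero    = v
  (v ◂ w) (suc n) = w n

  ◂-injectiveBelow : ∀ {v w n} → (∀ {k} → k < n → w k ≢ v) →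
                     InjectiveBelow n w → InjectiveBelow (suc n) (v ◂ w)
  ◂-injectiveBelow fresh inj {zero}  {zero}  _       _       _  = refl
  ◂-injectiveBelow fresh inj {zero}  {suc b} _       (s≤s b<) eq = contradiction (sym eq) (fresh b<)
  ◂-injectiveBelow fresh inj {suc a} {zero}  (s≤s a<) _       eq = contradiction eq (fresh a<)
  ◂-injectiveBelow fresh inj {suc a} {suc b} (s≤s a<) (s≤s b<) eq = cong suc (inj a< b< eq)

  shift-injectiveBelow : ∀ {w} n k → InjectiveBelow (n + k) w →
                         InjectiveBelow n (λ i → w (i + k))
  shift-injectiveBelow n k inj a< b< eq =
    +-cancelʳ-≡ k _ _ (inj (+-monoˡ-< k a<) (+-monoˡ-< k b<) eq)

  -- The two indices differ only at the last position, where the cyclic successor wraps to 0 and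
  -- `w n ≡ w 0` repairs the mismatch.
  closed-succ : ∀ {n} .{{_ : NonZero n}} (w : ℕ → V) → w n ≡ w 0 →
                ∀ (i : Fin n) → w (toℕ (succ i)) ≡ w (suc (toℕ i))
  closed-succ {n} w close i with m≤n⇒m<n∨m≡n (Fin.toℕ<n i)
  ... | inj₁ 1+i<n = cong w (trans (toℕ-mod (suc (toℕ i)) n) (m<n⇒m%n≡m 1+i<n))
  ... | inj₂ 1+i≡n = trans
    (cong w (trans (toℕ-mod (suc (toℕ i)) n) (trans (cong (_% n) 1+i≡n) (n%n≡0 n))))
    (sym (trans (cong w 1+i≡n) close))

  record SimplePath (R : Rel V 0ℓ) (u v : V) : Set where
    field
      length  : ℕ
      at      : ℕ → V
      start   : at 0 ≡ u
      end     : at length ≡ v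
      simple  : InjectiveBelow (suc length) at
      linked  : ∀ {k} → k < length → R (at k) (at (suc k))

  module _ (_≟ⱽ_ : DecidableEquality V) where

    injectiveBelow⊎firstRepeat : ∀ w n → InjectiveBelow n w ⊎ FirstRepeat n w
    injectiveBelow⊎firstRepeat w zero    = inj₁ λ ()
    injectiveBelow⊎firstRepeat w (suc n) with injectiveBelow⊎firstRepeat w n
    ... | inj₂ (i , j , i<j , j<n , rest) = inj₂ (i , j , i<j , m<n⇒m<1+n j<n , rest)
    ... | inj₁ inj with anyUpTo? (λ i → w n ≟ⱽ w i) n
    ...   | yes (i , i<n , eq) = inj₂ (i , n , i<n , ≤-refl , eq , inj)
    ...   | no  fresh = inj₁ λ a< b< → go (m<1+n⇒m<n∨m≡n a<) (m<1+n⇒m<n∨m≡n b<)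
      where
      go : ∀ {a b} → a < n ⊎ a ≡ n → b < n ⊎ b ≡ n → w a ≡ w b → a ≡ b
      go (inj₁ a<n)  (inj₁ b<n)  eq = inj a<n b<n eq
      go (inj₁ a<n)  (inj₂ refl) eq = contradiction (_ , a<n , sym eq) fresh
      go (inj₂ refl) (inj₁ b<n)  eq = contradiction (_ , b<n , eq) fresh
      go (inj₂ refl) (inj₂ refl) eq = refl

    -- If the new first vertex already occurs on the simple path of the tail, the part before that
    -- occurrence is cut off; otherwise the vertex is prepended.
    star⇒simplePath : ∀ {R : Rel V 0ℓ} {u v} → Star R u v → SimplePath R u v
    star⇒simplePath {u = u} ε = record
      { length = 0 ; at = λ _ → u ; start = refl ; end = refl
      ; simple = λ { (s≤s z≤n) (s≤s z≤n) _ → refl } ; linked = λ () }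
    star⇒simplePath {R} {u} (step ◅ steps) with star⇒simplePath steps
    ... | p with anyUpTo? (λ k → SimplePath.at p k ≟ⱽ u) (suc (SimplePath.length p))
    ...   | yes (k , s≤s k≤ , eq) = record
      { length = length ∸ k
      ; at     = λ i → at (i + k)
      ; start  = eq
      ; end    = trans (cong at (m∸n+n≡m k≤)) end
      ; simple = shift-injectiveBelow (suc (length ∸ k)) k
                   (subst (λ n → InjectiveBelow (suc n) at) (sym (m∸n+n≡m k≤)) simple)
      ; linked = λ i< → linked (subst (_ <_) (m∸n+n≡m k≤) (+-monoˡ-< k i<))
      } where open SimplePath p
    ...   | no fresh = record
      { length = suc length
      ; at     = u ◂ at
      ; start  = refl
      ; end    = end
      ; simple = ◂-injectiveBelow (λ k< eq → fresh (_ , k< , eq)) simple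
      ; linked = λ { {zero} _ → subst (R u) (sym start) step ; {suc k} (s≤s k<) → linked k< }
      } where open SimplePath p

module _ (G : Graph) where
  open Graph G using (Vertex; Adj)

  cycleThrough : ∀ (w : ℕ → Vertex) m → InjectiveBelow (3 + m) w →
    (∀ {k} → k < 3 + m → Adj (w k) (w (suc k))) → w (3 + m) ≡ w 0 → Cycle G
  cycleThrough w m inj adj close = record
    { excess   = m
    ; vertex   = w ∘ toℕ
    ; distinct = λ {i} {j} eq → Fin.toℕ-injective (inj (Fin.toℕ<n i) (Fin.toℕ<n j) eq)
    ; adjacent = λ i → subst (Adj _) (sym (closed-succ w close i)) (adj (Fin.toℕ<n i))
    }

-- Pseudoforests have orientations of out-degree at most one

module _ (G : Graph) where
  open Graph G renaming (sym to adj-sym)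

  -- Partial: edges not yet inserted carry no direction.
  record Orientation : Set where
    field
      out     : Vertex → Maybe Vertex
      sound   : ∀ {u v} → out u ≡ just v → Adj u v
      antisym : ∀ {u v} → out u ≡ just v → out v ≢ just u

  open Orientation

  Oriented : Orientation → Rel Vertex 0ℓ
  Oriented O u v = out O u ≡ just v ⊎ out O v ≡ just u

  oriented⇒adj : ∀ O {u v} → Oriented O u v → Adj u v
  oriented⇒adj O (inj₁ u→v) = sound O u→v
  oriented⇒adj O (inj₂ v→u) = adj-sym (sound O v→u)

  infix 4 _⊑_
  -- Only the inserted edges are compared, not their directions, so reversing edges is allowed.
  _⊑_ : Rel Orientation 0ℓ
  O ⊑ O′ = ∀ {u v} → Oriented O u v → Oriented O′ u v

  Free : Orientation → Vertex → Set
  Free O u = out O u ≡ nothing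

  empty : Orientation
  empty = record { out = λ _ → nothing ; sound = λ () ; antisym = λ () }

  data Escapes (O : Orientation) : Vertex → Set where
    stop : ∀ {u} → Free O u → Escapes O u
    step : ∀ {u v} → out O u ≡ just v → Escapes O v → Escapes O u

  -- Directions are forgotten here: the contradiction only needs a cycle of inserted edges that is
  -- joined to `u` by inserted edges.
  record Trapped (O : Orientation) (u : Vertex) : Set where
    field
      cycle    : Cycle G
      oriented : ∀ i → Oriented O (Cycle.vertex cycle i) (Cycle.vertex cycle (Cycle.next cycle i))
      reached  : ∀ i → Star (Oriented O) u (Cycle.vertex cycle i)

    edges⊆ : ∀ {x y} → Cycle.Edge cycle x y → Oriented O x y
    edges⊆ (i , inj₁ (refl , refl)) = oriented i
    edges⊆ (i , inj₂ (refl , refl)) = Sum.swap (oriented i)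

  -- Modifying an orientation

  module _ (_≟ⱽ_ : DecidableEquality Vertex) where

    infixl 10 _[_≔_]
    _[_≔_] : (Vertex → Maybe Vertex) → Vertex → Maybe Vertex → Vertex → Maybe Vertex
    (f [ u ≔ m ]) v with u ≟ⱽ v
    ... | yes _ = m
    ... | no  _ = f v

    ≔-at : ∀ f u m → (f [ u ≔ m ]) u ≡ m
    ≔-at f u m with u ≟ⱽ u
    ... | yes _  = refl
    ... | no u≢u = contradiction refl u≢u

    ≔-other : ∀ f {u m v} → u ≢ v → (f [ u ≔ m ]) v ≡ f v
    ≔-other f {u} {v = v} u≢v with u ≟ⱽ v
    ... | yes u≡v = contradiction u≡v u≢v
    ... | no  _   = refl

    erase : Orientation → Vertex → Orientation
    erase O u = record
      { out     = out O [ u ≔ nothing ]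
      ; sound   = sound O ∘ old
      ; antisym = λ v→w w→v → antisym O (old v→w) (old w→v)
      }
      where
      old : ∀ {v w} → (out O [ u ≔ nothing ]) v ≡ just w → out O v ≡ just w
      old {v} eq with u ≟ⱽ v
      old {v} () | yes _
      old {v} eq | no  _ = eq

    assign : ∀ O u v → Adj u v → out O v ≢ just u → Orientation
    assign O u v adj v↛u = record
      { out     = out O [ u ≔ just v ]
      ; sound   = λ {x} {y} eq → case assigned x eq of λ
        { (inj₁ (refl , refl)) → adj
        ; (inj₂ x→y)           → sound O x→y }
      ; antisym = λ {x} {y} x→y y→x → case assigned x x→y , assigned y y→x of λ
        { (inj₁ (refl , refl) , inj₁ (refl , _))    → irrefl refl adj
        ; (inj₁ (refl , refl) , inj₂ v→u)           → v↛u v→u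
        ; (inj₂ v→u           , inj₁ (refl , refl)) → v↛u v→u
        ; (inj₂ x→y           , inj₂ y→x)           → antisym O x→y y→x }
      }
      where
      assigned : ∀ x {y} → (out O [ u ≔ just v ]) x ≡ just y →
                (u ≡ x × v ≡ y) ⊎ out O x ≡ just y
      assigned x eq with u ≟ⱽ x
      ... | yes u≡x = inj₁ (u≡x , just-injective eq)
      ... | no  _   = inj₂ eq

    assign-⊑ : ∀ O u v adj v↛u → Free O u → O ⊑ assign O u v adj v↛u
    assign-⊑ O u v adj v↛u free = Sum.map keep keep
      where
      keep : ∀ {x y} → out O x ≡ just y → (out O [ u ≔ just v ]) x ≡ just y
      keep {x} x→y = trans
        (≔-other (out O) λ { refl → case trans (sym free) x→y of λ () }) x→y

    -- The out-edge of `u` is erased before `v` receives the opposite one, so the edge never carries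
    -- both directions.
    reverse-edge : ∀ O {u v} → out O u ≡ just v → Free O v →
                   ∃[ O′ ] O ⊑ O′ × Free O′ u
    reverse-edge O {u} {v} u→v free =
      O₂ , [ keep , Sum.swap ∘ keep ]′ , trans (≔-other (out O₁) (u≢v ∘ sym)) (≔-at (out O) u nothing)
      where
      u≢v : u ≢ v
      u≢v u≡v = irrefl u≡v (sound O u→v)

      O₁ O₂ : Orientation
      O₁ = erase O u

      u↛v : out O₁ u ≢ just v
      u↛v eq = case trans (sym (≔-at (out O) u nothing)) eq of λ ()

      O₂ = assign O₁ v u (adj-sym (sound O u→v)) u↛v

      keep : ∀ {x y} → out O x ≡ just y → Oriented O₂ x y
      keep {x} {y} x→y with u ≟ⱽ x
      -- The only edge lost by erasing is the one between `u` and `v`, and it returns reversed.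
      ... | yes refl rewrite just-injective (trans (sym x→y) u→v) =
        inj₂ (≔-at (out O₁) v (just u))
      ... | no u≢x = assign-⊑ O₁ v u (adj-sym (sound O u→v)) u↛v (trans (≔-other (out O) u≢v) free)
        (inj₁ (trans (≔-other (out O) u≢x) x→y))

    -- The path is reversed from its free end backwards: each reversal passes the free slot one
    -- vertex towards `u`.
    escapes⇒free : ∀ O {u} → Escapes O u → ∃[ O′ ] O ⊑ O′ × Free O′ u
    escapes⇒free O (stop free) = O , (λ e → e) , free
    escapes⇒free O (step u→v esc)
      with O₁ , O⊑O₁ , free ← escapes⇒free O esc
      -- `O⊑O₁` does not preserve directions, so the edge is looked up again; it cannot leave `v`,
      -- which is now free.
      with O⊑O₁ (inj₁ u→v)
    ... | inj₂ v→u = case trans (sym free) v→u of λ ()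
    ... | inj₁ u→v′ with O₂ , O₁⊑O₂ , free′ ← reverse-edge O₁ u→v′ free =
      O₂ , (λ e → O₁⊑O₂ (O⊑O₁ e)) , free′

    orient-free : ∀ O {u v} → Free O u → Adj u v → ∃[ O′ ] O ⊑ O′ × Oriented O′ u v
    -- The edge may already be present from `v` to `u`, and assigning it again would break
    -- `antisym`.
    orient-free O {u} {v} free adj with ≡-dec _≟ⱽ_ (out O v) (just u)
    ... | yes v→u = O , (λ e → e) , inj₂ v→u
    ... | no  v↛u = assign O u v adj v↛u , assign-⊑ O u v adj v↛u free ,
                    inj₁ (≔-at (out O) u (just v))

    orient-escaping : ∀ O {u v} → Escapes O u → Adj u v → ∃[ O′ ] O ⊑ O′ × Oriented O′ u v
    orient-escaping O esc adj
      with O₁ , O⊑O₁ , free ← escapes⇒free O esc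
      with O₂ , O₁⊑O₂ , new ← orient-free O₁ free adj
      = O₂ , (λ e → O₁⊑O₂ (O⊑O₁ e)) , new

    -- Out-paths in a finite graph

    module _ {N} (index : Vertex ↣ Fin N) where

      firstRepeat : ∀ w → FirstRepeat (suc N) w
      firstRepeat w with injectiveBelow⊎firstRepeat _≟ⱽ_ w (suc N)
      ... | inj₂ repeat = repeat
      ... | inj₁ inj
        with i , j , i<j , eq ← Fin.pigeonhole (n<1+n N) (Injection.to index ∘ w ∘ toℕ)
        = contradiction
            (inj (Fin.toℕ<n i) (Fin.toℕ<n j) (Injection.injective index eq))
            (<⇒≢ i<j)

      module _ (O : Orientation) (u : Vertex) where

        orbit : ℕ → Vertex
        orbit zero    = u
        -- The default lets the walk stay put at a free vertex, which makes the sequence total.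
        orbit (suc k) = fromMaybe (orbit k) (out O (orbit k))

        Moves : ℕ → Set
        Moves k = out O (orbit k) ≡ just (orbit (suc k))

        moves⊎free : ∀ k → Moves k ⊎ Free O (orbit k)
        moves⊎free k with out O (orbit k)
        ... | just _  = inj₁ refl
        ... | nothing = inj₂ refl

        -- Going back one position, the walk either moved, giving one more step, or stood at a free
        -- vertex, which escapes at once.
        escapes-back : ∀ k → Escapes O (orbit k) → Escapes O u
        escapes-back zero    esc = esc
        escapes-back (suc k) esc = escapes-back k
          ([ (λ moves → step moves esc) , stop ]′ (moves⊎free k))

        orbit-reached : ∀ k → (∀ {l} → l < k → Moves l) → Star (Oriented O) u (orbit k)
        orbit-reached zero    moves = ε
        orbit-reached (suc k) moves =
          orbit-reached k (moves ∘ m<n⇒m<1+n) ◅◅ (inj₁ (moves ≤-refl) ◅ ε)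

        -- `n` is the length of the closed part of the walk. Length 1 would be a loop and length 2 a
        -- pair of opposite out-edges, both excluded by `antisym`; from 3 on it is a cycle.
        repeat⇒trapped : ∀ i n → 0 < n → (∀ {l} → l < n + i → Moves l) →
                         orbit (n + i) ≡ orbit i → InjectiveBelow (n + i) orbit → Trapped O u
        repeat⇒trapped i 1 _ moves eq _ =
          let loop = subst (λ v → out O (orbit i) ≡ just v) eq (moves ≤-refl)
          in contradiction loop (antisym O loop)
        repeat⇒trapped i 2 _ moves eq _ = contradiction
          (subst (λ v → out O (orbit (suc i)) ≡ just v) eq (moves ≤-refl))
          (antisym O (moves (n≤1+n _)))
        repeat⇒trapped i n@(suc (suc (suc m))) _ moves eq inj = record
          { cycle    = cycleThrough G w m (shift-injectiveBelow n i inj)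
                         (λ k< → sound O (moves′ k<)) eq
          ; oriented = λ k → subst (Oriented O _) (sym (closed-succ w eq k))
                         (inj₁ (moves′ (Fin.toℕ<n k)))
          ; reached  = λ k → orbit-reached (toℕ k + i)
                         (λ l< → moves (<-trans l< (+-monoˡ-< i (Fin.toℕ<n k))))
          }
          where
          w : ℕ → Vertex
          w k = orbit (k + i)

          moves′ : ∀ {k} → k < n → Moves (k + i)
          moves′ k<n = moves (+-monoˡ-< i k<n)

        -- It suffices to inspect `suc N` positions: if the walk moves from all of them, two of
        -- these vertices coincide by the pigeonhole principle.
        trapped⊎escapes : Trapped O u ⊎ Escapes O u
        trapped⊎escapes with ∀⊎∃ {suc N} (λ k → moves⊎free (toℕ k))
        ... | inj₂ (k , free) = inj₂ (escapes-back (toℕ k) (stop free))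
        ... | inj₁ moves with i , j , i<j , j<1+N , eq , inj ← firstRepeat orbit
          = inj₁ (repeat⇒trapped i (j ∸ i) (m<n⇒0<n∸m i<j)
              (λ {l} l< → moves-below (<-trans (subst (l <_) j∸i+i l<) j<1+N))
              (trans (cong orbit j∸i+i) eq)
              (subst (λ n → InjectiveBelow n orbit) (sym j∸i+i) inj))
          where
          j∸i+i : j ∸ i + i ≡ j
          j∸i+i = m∸n+n≡m (<⇒≤ i<j)

          moves-below : ∀ {l} → l < suc N → Moves l
          moves-below l< = subst Moves (Fin.toℕ-fromℕ< l<) (moves (fromℕ< l<))

      -- Inserting an edge

      closing-cycle : ∀ O {u v} → Adj u v → ¬ Oriented O u v → SimplePath (Oriented O) u v →
                      ∃[ C ] Cycle.Edge C v u × Cycle.vertex C zero ≡ v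
      closing-cycle O adj new record { length = 0 ; start = start ; end = end } =
        contradiction adj (irrefl (trans (sym start) end))
      closing-cycle O adj new record { length = 1 ; start = start ; end = end ; linked = linked } =
        contradiction (subst₂ (Oriented O) start end (linked ≤-refl)) new
      closing-cycle O {u} {v} adj new p@record { length = n@(suc (suc m)) } =
        -- The cycle starts at `v` and then follows the path from `u`; the final vertex of the path
        -- is `v` again and supplies the closing equation.
        cycleThrough G w m
          (◂-injectiveBelow (λ k<n eq → <⇒≢ k<n (simple (m<n⇒m<1+n k<n) ≤-refl (trans eq (sym end))))
            (λ a< b< → simple (m<n⇒m<1+n a<) (m<n⇒m<1+n b<)))
          links end
        , (zero , inj₁ (refl , sym (trans (closed-succ w end zero) start)))
        , refl
        where
        open SimplePath p

        w : ℕ → Vertex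
        w = v ◂ at

        links : ∀ {k} → k < suc n → Adj (w k) (w (suc k))
        links {zero}  _        = subst (Adj v) (sym start) (adj-sym adj)
        links {suc k} (s≤s k<) = oriented⇒adj O (linked k<)

      both-trapped : IsPseudoforest G → ∀ O {u v} → Adj u v → ¬ Oriented O u v →
                     Trapped O u → Trapped O v → ⊥
      both-trapped pf O {u} {v} adj new tᵤ tᵥ =
        -- By uniqueness the closed-up cycle `E` is `C`, all of whose edges are inserted, whereas
        -- `E` contains the edge between `v` and `u`.
        new (Sum.swap (edges⊆ tᵤ (Equivalence.from (same E E⊆K v u) vu∈E)))
        where
        open Trapped
        C = cycle tᵤ
        D = cycle tᵥ

        same : ∀ D → _LiesIn_ G D (Component G u) → SameCycle G C D
        same D = pf u C D (λ i → Star.map (oriented⇒adj O) (reached tᵤ i))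

        C₀∈D : ∃[ i ] Cycle.vertex C zero ≡ Cycle.vertex D i
        C₀∈D = edge-source G D (Equivalence.to
          -- `D` is reached from `v`, and so lies in the component of `u` by way of the new edge,
          -- which belongs to `G`.
          (same D (λ i → adj ◅ Star.map (oriented⇒adj O) (reached tᵥ i)) _ _)
          (zero , inj₁ (refl , refl)))

        u⟶v : Star (Oriented O) u v
        -- Only inserted edges are used: from `u` to the vertex shared by both cycles, then back
        -- along the path from `v`.
        u⟶v with i , eq ← C₀∈D = reached tᵤ zero
          ◅◅ subst (λ x → Star (Oriented O) x v) (sym eq) (Star.reverse Sum.swap (reached tᵥ i))

        closing = closing-cycle O adj new (star⇒simplePath _≟ⱽ_ u⟶v)
        E    = proj₁ closing
        vu∈E = proj₁ (proj₂ closing)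

        E⊆K : _LiesIn_ G E (Component G u)
        E⊆K = liesIn G E {i = zero}
          (subst (Star Adj u) (sym (proj₂ (proj₂ closing))) (adj ◅ ε))

      insert : IsPseudoforest G → ∀ O {u v} → Adj u v → ∃[ O′ ] O ⊑ O′ × Oriented O′ u v
      insert pf O {u} {v} adj
        with ≡-dec _≟ⱽ_ (out O u) (just v) ⊎-dec ≡-dec _≟ⱽ_ (out O v) (just u)
      ... | yes old = O , (λ e → e) , old
      ... | no  new with trapped⊎escapes O u | trapped⊎escapes O v
      ...   | inj₂ esc | _        = orient-escaping O esc adj
      ...   | inj₁ _   | inj₂ esc with O′ , O⊑O′ , v-u ← orient-escaping O esc (adj-sym adj)
                                  = O′ , O⊑O′ , Sum.swap v-u
      ...   | inj₁ tᵤ  | inj₁ tᵥ  = ⊥-elim (both-trapped pf O adj new tᵤ tᵥ)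

      pseudoforest⇒oriented : IsPseudoforest G → ∀ es → All (uncurry Adj) es →
                              ∃[ O ] All (uncurry (Oriented O)) es
      pseudoforest⇒oriented pf []       []           = empty , []
      pseudoforest⇒oriented pf (e ∷ es) (adj ∷ adjs)
        with O , old ← pseudoforest⇒oriented pf es adjs
        with O′ , O⊑O′ , new ← insert pf O adj
        = O′ , new ∷ All.map O⊑O′ old

-- The two-spine graph

rowCol↣⊎ : ∀ {q} → RowCol q ↣ (Fin q ⊎ Fin q)
rowCol↣⊎ {q} = mk↣ {to = to} injective
  where
  to : RowCol q → Fin q ⊎ Fin q
  to (row x) = inj₁ x
  to (col y) = inj₂ y

  injective : ∀ {u v} → to u ≡ to v → u ≡ v
  injective {row _} {row _} eq = cong row (inj₁-injective eq)
  injective {col _} {col _} eq = cong col (inj₂-injective eq)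

rowCol↣Fin : ∀ {q} → RowCol q ↣ Fin (q + q)
rowCol↣Fin = ↔⇒↣ (Symmetry.inverse Fin.+↔⊎) ↣-∘ rowCol↣⊎

module _ {q} (P : TwoSpine q) where
  open TwoSpine P

  data Owns (P₁ P₂ : Fin q × Fin q → Set) : Rel (RowCol q) 0ℓ where
    col-owns : ∀ {x y} → P₁ (x , y) → Owns P₁ P₂ (col y) (row x)
    row-owns : ∀ {x y} → P₂ (x , y) → Owns P₁ P₂ (row x) (col y)

  coverable⇒pseudoforest : Coverable P → IsPseudoforest (bipartiteGraph P)
  coverable⇒pseudoforest (P₁ , P₂ , (P⊆ , _) , _ , column , row′) =
    oriented⇒pseudoforest (bipartiteGraph P) (Owns P₁ P₂) functional covers
    where
    functional : ∀ {u v w} → Owns P₁ P₂ u v → Owns P₁ P₂ u w → v ≡ w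
    functional (col-owns p) (col-owns p′) = cong row (column p p′)
    functional (row-owns p) (row-owns p′) = cong col (row′ p p′)

    covers : ∀ {u v} → Joined P u v → Owns P₁ P₂ u v ⊎ Owns P₁ P₂ v u
    covers (row-col p) = Sum.swap (Sum.map col-owns row-owns (P⊆ p))
    covers (col-row p) = Sum.map col-owns row-owns (P⊆ p)

  edge : Fin q × Fin q → RowCol q × RowCol q
  edge (x , y) = row x , col y

  allPairs pairList : List (Fin q × Fin q)
  allPairs = cartesianProduct (allFin q) (allFin q)
  pairList = filter pairs? allPairs

  pseudoforest⇒coverable : IsPseudoforest (bipartiteGraph P) → Coverable P
  pseudoforest⇒coverable pf
    with O , oriented ← pseudoforest⇒oriented (bipartiteGraph P)
           (via-injection rowCol↣Fin Fin._≟_) rowCol↣Fin pf (map edge pairList)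
           (All.map⁺ (All.map row-col (All.all-filter pairs? allPairs)))
    = let open Orientation O in
      -- The parts are read off from ownership. Each vertex has at most one out-edge, which gives
      -- the row and column bounds, and `antisym` makes the parts disjoint.
      (λ (x , y) → out (col y) ≡ just (row x))
    , (λ (x , y) → out (row x) ≡ just (col y))
    , ( (λ {(x , y)} p → Sum.swap (All.lookup oriented (∈-map⁺ edge
          (∈-filter⁺ pairs? (∈-cartesianProduct⁺ (∈-allFin x) (∈-allFin y)) p))))
      , [ (λ c → pair (adj-sym (sound c))) , (λ r → pair (sound r)) ]′ )
    , (λ (c , r) → antisym c r)
    , (λ c c′ → row-injective (trans (sym c) c′))
    , (λ r r′ → col-injective (trans (sym r) r′))
    where
    open Graph (bipartiteGraph P) renaming (sym to adj-sym)

    pair : ∀ {x y} → Joined P (row x) (col y) → pairs (x , y)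
    pair (row-col p) = p

    row-injective : ∀ {x x′} → just (row x) ≡ just (row x′) → x ≡ x′
    row-injective refl = refl

    col-injective : ∀ {y y′} → just (col y) ≡ just (col y′) → y ≡ y′
    col-injective refl = refl

lemma4p1 : ∀ (q : ℕ) .{{_ : NonZero q}} (P : TwoSpine q) →
    Coverable P ⇔ IsPseudoforest (bipartiteGraph P)
lemma4p1 q P = mk⇔ (coverable⇒pseudoforest P) (pseudoforest⇒coverable P)
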